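{- If $k\ge 4$ is even then there exists a maximal $\mathcal{NAS}_k(2)$.
   Context: For a sequence $S=(s_i)_{i\ge0}$ with entries in $\mathbb{Z}_k$ write $\mathbf{s}_n(i)=(s_i,\dots,s_{i+n-1})$; an $n$-tuple occurs in $S$ if it equals $\mathbf{s}_n(i)$ for some $i$. A $k$-ary $n$-window sequence is a periodic sequence over $\mathbb{Z}_k$, of period $m$ say, such that $\mathbf{s}_n(i)=\mathbf{s}_n(j)$ implies $i\equiv j\pmod m$. For $k\ge3$, $n\ge2$, an $\mathcal{NAS}_k(n)$ ($k$-ary Negative Avoiding Sequence of span $n$) is a $k$-ary $n$-window sequence $S$ such that whenever an $n$-tuple $\mathbf{a}=(a_0,\dots,a_{n-1})$ occurs in $S$, its negative $-\mathbf{a}=(-a_0,\dots,-a_{n-1})$ does not occur in $S$. An $\mathcal{NAS}_k(n)$ is maximal if its period equals $\frac{k^n-1}{2}$ when $k$ is odd, or $\frac{k^n-2^n}{2}$ when $k$ is even. -}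

module Defs where

open import Data.Fin using (Fin; toℕ)
open import Data.Nat using (ℕ; suc; _+_; _∸_; _^_; _≤_; _<_; ∣_-_∣)
open import Data.Nat.DivMod using (_/_; _mod_)
open import Data.Nat.Divisibility using (_∣_)
open import Data.Product using (∃-syntax)
open import Data.Vec using (Vec; map; tabulate)
open import Relation.Binary.PropositionalEquality using (_≡_)
open import Relation.Nullary using (¬_)

-- Fin k represents ℤ_k through the residues 0, …, k − 1.
-- Fin.opposite is not negation modulo k: it sends i to k − 1 − i.
neg : ∀ {k} → Fin k → Fin k
neg {suc k} x = (suc k ∸ toℕ x) mod suc k

Sequence : ℕ → Set
Sequence k = ℕ → Fin k

module _ {k : ℕ} where

  window : Sequence k → (n : ℕ) → ℕ → Vec (Fin k) n
  window S n i = tabulate (λ j → S (i + toℕ j))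

  _OccursIn_ : ∀ {n} → Vec (Fin k) n → Sequence k → Set
  _OccursIn_ {n} a S = ∃[ i ] window S n i ≡ a

  -- The period of a sequence is its least positive period.
  record HasPeriod (S : Sequence k) (m : ℕ) : Set where
    field
      positive : 0 < m
      periodic : ∀ i → S (i + m) ≡ S i
      least    : ∀ p → 0 < p → (∀ i → S (i + p) ≡ S i) → m ≤ p

  record IsWindowSequence (n : ℕ) (S : Sequence k) (m : ℕ) : Set where
    field
      hasPeriod : HasPeriod S m
      distinct  : ∀ i j → window S n i ≡ window S n j → m ∣ ∣ i - j ∣

  record IsNAS (n : ℕ) (S : Sequence k) (m : ℕ) : Set where
    field
      3≤k              : 3 ≤ k
      2≤n              : 2 ≤ n
      isWindowSequence : IsWindowSequence n S m
      negativeAvoiding : ∀ (a : Vec (Fin k) n) → a OccursIn S → ¬ (map neg a OccursIn S)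

  record IsMaximalNAS (n : ℕ) (S : Sequence k) : Set where
    field
      period  : ℕ
      isNAS   : IsNAS n S period
      maxOdd  : ¬ (2 ∣ k) → period ≡ (k ^ n ∸ 1) / 2
      maxEven : 2 ∣ k → period ≡ (k ^ n ∸ 2 ^ n) / 2

{-# OPTIONS --safe #-}
-- Write k = 2(m + 1), so that ℤ_k consists of 0, h = m + 1 and ±1, …, ±m.  For 1 ≤ a ≤ m let B_a
-- be the word
--   0, a, 1, a, −1, a, 2, a, −2, …, a, a − 1, a, −(a − 1), a, a, h, a, −a
-- of length 4a + 2.  Followed by the 0 that opens the next block, it runs exactly once through one
-- pair of each class {(x, y), (−x, −y)} in which a is the larger of |x| and |y| (h not counted).
-- So the cyclic word B_1 B_2 … B_m uses every class other than the self-negative ones once, and its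
-- length is Σ (4a + 2) = 2m(m + 2) = (k² − 4)/2.
module Submission where

open import Defs
open import Data.Empty using (⊥)
open import Data.Fin using (Fin; toℕ; fromℕ<)
open import Data.Fin.Properties using (toℕ-fromℕ<; toℕ-injective)
open import Data.Nat using (ℕ; zero; suc; _+_; _*_; _∸_; _^_; _≤_; _<_; z≤n; s≤s; z<s; NonZero; ∣_-_∣; _<?_)
open import Data.Nat.DivMod
open import Data.Nat.Divisibility using (_∣_; divides; ∣⇒≤)
open import Data.Nat.Properties
open import Data.Nat.Tactic.RingSolver using (solve-∀)
open import Data.Product using (Σ; ∃; ∃₂; _×_; _,_; proj₁; proj₂)
open import Data.Sum using (_⊎_; inj₁; inj₂)
open import Data.Vec using ([]; _∷_; map)
open import Data.Vec.Properties using (∷-injective; tabulate-cong)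
open import Relation.Binary.PropositionalEquality
open import Relation.Nullary using (contradiction; recompute)

-- Remainders and block lengths.

%-≡⇒∣∣-∣ : ∀ i j n .{{_ : NonZero n}} → i % n ≡ j % n → n ∣ ∣ i - j ∣
%-≡⇒∣∣-∣ i j n eq = divides ∣ i / n - j / n ∣ (begin
  ∣ i - j ∣
    ≡⟨ cong₂ ∣_-_∣ (m≡m%n+[m/n]*n i n) (m≡m%n+[m/n]*n j n) ⟩
  ∣ i % n + i / n * n - j % n + j / n * n ∣
    ≡⟨ cong (λ r → ∣ i % n + i / n * n - r + j / n * n ∣) (sym eq) ⟩
  ∣ i % n + i / n * n - i % n + j / n * n ∣
    ≡⟨ ∣m+n-m+o∣≡∣n-o∣ (i % n) _ _ ⟩
  ∣ i / n * n - j / n * n ∣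
    ≡⟨ *-distribʳ-∣-∣ n (i / n) (j / n) ⟨
  ∣ i / n - j / n ∣ * n ∎)
  where open ≡-Reasoning

suc-%-% : ∀ i n .{{_ : NonZero n}} → suc (i % n) % n ≡ suc i % n
suc-%-% i n = trans (sym ([m+kn]%n≡m%n (suc (i % n)) (i / n) n))
                    (cong (λ j → suc j % n) (sym (m≡m%n+[m/n]*n i n)))

-- The successor clause adds 4(a + 1) + 2, the length of the next block, arranged so that the
-- positions of consecutive edges match by computation in `next`.
blockStart : ℕ → ℕ
blockStart zero    = 0
blockStart (suc a) = 6 + (a * 4 + blockStart a)

blockStart-mono : ∀ {a b} → a ≤ b → blockStart a ≤ blockStart b
blockStart-mono z≤n       = z≤n
blockStart-mono (s≤s a≤b) = +-monoʳ-≤ 6 (+-mono-≤ (*-monoˡ-≤ 4 a≤b) (blockStart-mono a≤b))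

blockStart-closed : ∀ a → blockStart a ≡ a * (a + 2) * 2
blockStart-closed zero    = refl
blockStart-closed (suc a) = trans (cong (λ b → 6 + (a * 4 + b)) (blockStart-closed a)) (step a)
  where
  step : ∀ a → 6 + (a * 4 + a * (a + 2) * 2) ≡ (1 + a) * ((1 + a) + 2) * 2
  step = solve-∀

module Construction (n : ℕ) where

  -- Taking `m` to be a successor makes `length` compute to one as well, hence visibly nonzero as a
  -- modulus.
  m k length : ℕ
  m = suc n
  k = suc m + suc m
  length = blockStart m

  -- Letters as signed residues modulo `k`.

  -- pos a and neg a stand for the residues a + 1 and −(a + 1).
  data Letter : Set where
    O H      : Letter
    pos neg′ : (a : ℕ) → .(a < m) → Letter

  negate : Letter → Letter
  negate O          = O
  negate H          = H
  negate (pos a p)  = neg′ a p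
  negate (neg′ a p) = pos a p

  -- The last clause is `k` minus a + 1, written as an offset from the residue of `H`: positive
  -- letters lie below `H`, negative ones above.
  residue : Letter → ℕ
  residue O          = 0
  residue H          = suc m
  residue (pos a _)  = suc a
  residue (neg′ a _) = suc m + (m ∸ a)

  -- The bound in a letter is irrelevant so that letters of equal index agree whatever proof they
  -- carry; the arithmetic needs it back.
  bounded : ∀ {a} → .(a < m) → a < m
  bounded {a} p = recompute (a <? m) p

  residue<k : ∀ x → residue x < k
  residue<k O          = z<s
  residue<k H          = m<m+n (suc m) z<s
  residue<k (pos a p)  = ≤-trans (s≤s (bounded p)) (m≤m+n (suc m) (suc m))
  residue<k (neg′ a _) = +-monoʳ-< (suc m) (s≤s (m∸n≤m m a))

  pos<H : ∀ {a} → .(a < m) → suc a < suc m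
  pos<H p = s≤s (bounded p)

  H<neg : ∀ {a} → .(a < m) → suc m < suc m + (m ∸ a)
  H<neg p = m<m+n (suc m) (m<n⇒0<n∸m (bounded p))

  residue-injective : ∀ x y → residue x ≡ residue y → x ≡ y
  residue-injective O          O          _  = refl
  residue-injective H          H          _  = refl
  residue-injective (pos a _)  (pos .a _) refl = refl
  residue-injective (neg′ a p) (neg′ b q) eq
    with refl ← ∸-cancelˡ-≡ (<⇒≤ (bounded p)) (<⇒≤ (bounded q)) (+-cancelˡ-≡ (suc m) _ _ eq) = refl
  residue-injective H          (pos _ q)  eq = contradiction (sym eq) (<⇒≢ (pos<H q))
  residue-injective H          (neg′ _ q) eq = contradiction eq (<⇒≢ (H<neg q))
  residue-injective (pos _ p)  H          eq = contradiction eq (<⇒≢ (pos<H p))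
  residue-injective (pos _ p)  (neg′ _ q) eq = contradiction eq (<⇒≢ (<-trans (pos<H p) (H<neg q)))
  residue-injective (neg′ _ p) H          eq = contradiction (sym eq) (<⇒≢ (H<neg p))
  residue-injective (neg′ _ p) (pos _ q)  eq = contradiction (sym eq) (<⇒≢ (<-trans (pos<H q) (H<neg p)))

  encode : Letter → Fin k
  encode x = fromℕ< (residue<k x)

  toℕ-encode : ∀ x → toℕ (encode x) ≡ residue x
  toℕ-encode x = toℕ-fromℕ< (residue<k x)

  encode-injective : ∀ {x y} → encode x ≡ encode y → x ≡ y
  encode-injective {x} {y} eq = residue-injective x y
    (trans (sym (toℕ-encode x)) (trans (cong toℕ eq) (toℕ-encode y)))

  residue-negate : ∀ x → (k ∸ residue x) % k ≡ residue (negate x)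
  -- The only case in which reduction modulo `k` changes the value.
  residue-negate O = n%n≡0 k
  residue-negate H = trans (cong (_% k) (m+n∸m≡n (suc m) (suc m))) (m<n⇒m%n≡m (residue<k H))
  residue-negate (pos a p) =
    trans (cong (_% k) complement) (m<n⇒m%n≡m (residue<k (neg′ a p)))
    where
    complement : m + suc m ∸ a ≡ suc m + (m ∸ a)
    complement = trans (cong (_∸ a) (+-comm m (suc m))) (+-∸-assoc (suc m) (<⇒≤ (bounded p)))
  residue-negate (neg′ a p) =
    trans (cong (_% k) complement) (m<n⇒m%n≡m (residue<k (pos a p)))
    where
    complement : k ∸ (suc m + (m ∸ a)) ≡ suc a
    complement = trans ([m+n]∸[m+o]≡n∸o (suc m) (suc m) (m ∸ a))
      (trans (+-∸-assoc 1 (m∸n≤m m a)) (cong suc (m∸[m∸n]≡n (<⇒≤ (bounded p)))))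

  neg-encode : ∀ x → neg (encode x) ≡ encode (negate x)
  neg-encode x = toℕ-injective (begin
    toℕ (neg (encode x))      ≡⟨ toℕ-fromℕ< _ ⟩
    (k ∸ toℕ (encode x)) % k  ≡⟨ cong (λ r → (k ∸ r) % k) (toℕ-encode x) ⟩
    (k ∸ residue x) % k       ≡⟨ residue-negate x ⟩
    residue (negate x)        ≡⟨ toℕ-encode (negate x) ⟨
    toℕ (encode (negate x))   ∎)
    where open ≡-Reasoning

  -- Edges of the cyclic word.

  -- Edge p x y: the cyclic word has x at position p and y right after it.
  data Edge : ℕ → Letter → Letter → Set where
    open-block : ∀ {a} (a<m : a < m) → Edge (blockStart a) O (pos a a<m)
    to-pos     : ∀ {i a} (i<a : i < a) (a<m : a < m) →
                 Edge (1 + (i * 4 + blockStart a)) (pos a a<m) (pos i (<-trans i<a a<m))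
    from-pos   : ∀ {i a} (i<a : i < a) (a<m : a < m) →
                 Edge (2 + (i * 4 + blockStart a)) (pos i (<-trans i<a a<m)) (pos a a<m)
    to-neg     : ∀ {i a} (i<a : i < a) (a<m : a < m) →
                 Edge (3 + (i * 4 + blockStart a)) (pos a a<m) (neg′ i (<-trans i<a a<m))
    from-neg   : ∀ {i a} (i<a : i < a) (a<m : a < m) →
                 Edge (4 + (i * 4 + blockStart a)) (neg′ i (<-trans i<a a<m)) (pos a a<m)
    loop       : ∀ {a} (a<m : a < m) → Edge (1 + (a * 4 + blockStart a)) (pos a a<m) (pos a a<m)
    to-H       : ∀ {a} (a<m : a < m) → Edge (2 + (a * 4 + blockStart a)) (pos a a<m) H
    from-H     : ∀ {a} (a<m : a < m) → Edge (3 + (a * 4 + blockStart a)) H (pos a a<m)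
    flip       : ∀ {a} (a<m : a < m) → Edge (4 + (a * 4 + blockStart a)) (pos a a<m) (neg′ a a<m)
    close      : ∀ {a} (a<m : a < m) → Edge (5 + (a * 4 + blockStart a)) (neg′ a a<m) O

  -- As c ≤ 5, the position stays below 6 + (a * 4 + blockStart a), the start of the next block.
  within-block : ∀ {c i a} → c ≤ 5 → i ≤ a → a < m → c + (i * 4 + blockStart a) < length
  within-block {a = a} c≤5 i≤a a<m = ≤-trans
    (s≤s (+-mono-≤ c≤5 (+-monoˡ-≤ (blockStart a) (*-monoˡ-≤ 4 i≤a)))) (blockStart-mono a<m)

  position<length : ∀ {p x y} → Edge p x y → p < length
  position<length (open-block a<m)   = within-block {0} {0} (m≤m+n 0 5) z≤n a<m
  position<length (to-pos i<a a<m)   = within-block (m≤m+n 1 4) (<⇒≤ i<a) a<m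
  position<length (from-pos i<a a<m) = within-block (m≤m+n 2 3) (<⇒≤ i<a) a<m
  position<length (to-neg i<a a<m)   = within-block (m≤m+n 3 2) (<⇒≤ i<a) a<m
  position<length (from-neg i<a a<m) = within-block (m≤m+n 4 1) (<⇒≤ i<a) a<m
  position<length (loop a<m)         = within-block (m≤m+n 1 4) ≤-refl a<m
  position<length (to-H a<m)         = within-block (m≤m+n 2 3) ≤-refl a<m
  position<length (from-H a<m)       = within-block (m≤m+n 3 2) ≤-refl a<m
  position<length (flip a<m)         = within-block (m≤m+n 4 1) ≤-refl a<m
  position<length (close a<m)        = within-block ≤-refl ≤-refl a<m

  -- The larger index names the block. Strictness of i < a keeps `to-pos`, `from-pos` and `loop`
  -- apart, and `to-neg` apart from `flip`.
  position-unique : ∀ {p q x y} → Edge p x y → Edge q x y → p ≡ q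
  position-unique (open-block _)   (open-block _)    = refl
  position-unique (to-pos _ _)     (to-pos _ _)      = refl
  position-unique (to-pos i<a _)   (from-pos a<i _)  = contradiction a<i (<-asym i<a)
  position-unique (to-pos a<a _)   (loop _)          = contradiction a<a (<-irrefl refl)
  position-unique (from-pos i<a _) (to-pos a<i _)    = contradiction a<i (<-asym i<a)
  position-unique (from-pos _ _)   (from-pos _ _)    = refl
  position-unique (from-pos a<a _) (loop _)          = contradiction a<a (<-irrefl refl)
  position-unique (to-neg _ _)     (to-neg _ _)      = refl
  position-unique (to-neg a<a _)   (flip _)          = contradiction a<a (<-irrefl refl)
  position-unique (from-neg _ _)   (from-neg _ _)    = refl
  position-unique (loop _)         (to-pos a<a _)    = contradiction a<a (<-irrefl refl)
  position-unique (loop _)         (from-pos a<a _)  = contradiction a<a (<-irrefl refl)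
  position-unique (loop _)         (loop _)          = refl
  position-unique (to-H _)         (to-H _)          = refl
  position-unique (from-H _)       (from-H _)        = refl
  position-unique (flip _)         (to-neg a<a _)    = contradiction a<a (<-irrefl refl)
  position-unique (flip _)         (flip _)          = refl
  position-unique (close _)        (close _)         = refl

  -- Only edges between a positive and a negative letter can matter. Starting positive, the first
  -- absolute value is at least the second; starting negative, it is strictly smaller. Negation
  -- swaps the signs but keeps absolute values.
  no-negated-edge : ∀ {p q x y} → Edge p x y → Edge q (negate x) (negate y) → ⊥
  no-negated-edge (to-neg i<a _)   (from-neg a<i _) = <-asym i<a a<i
  no-negated-edge (from-neg i<a _) (to-neg a<i _)   = <-asym i<a a<i
  no-negated-edge (from-neg a<a _) (flip _)         = <-irrefl refl a<a
  no-negated-edge (flip _)         (from-neg a<a _) = <-irrefl refl a<a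

  source-at-0 : ∀ {p x y} → Edge p x y → p ≡ 0 → x ≡ O
  source-at-0 (open-block _) _ = refl

  -- `loop` takes the turn i = a, once all smaller indices are exhausted.
  leave-top : ∀ {i a} → i ≤ a → (a<m : a < m) → ∃ (Edge (1 + (i * 4 + blockStart a)) (pos a a<m))
  leave-top i≤a a<m with m≤n⇒m<n∨m≡n i≤a
  ... | inj₁ i<a  = _ , to-pos i<a a<m
  ... | inj₂ refl = _ , loop a<m

  next : ∀ {p x y} → Edge p x y → ∃ (Edge (suc p) y) ⊎ (y ≡ O × suc p ≡ length)
  next (open-block a<m)   = inj₁ (leave-top z≤n a<m)
  next (to-pos i<a a<m)   = inj₁ (_ , from-pos i<a a<m)
  next (from-pos i<a a<m) = inj₁ (_ , to-neg i<a a<m)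
  next (to-neg i<a a<m)   = inj₁ (_ , from-neg i<a a<m)
  next (from-neg i<a a<m) = inj₁ (leave-top i<a a<m)
  next (loop a<m)         = inj₁ (_ , to-H a<m)
  next (to-H a<m)         = inj₁ (_ , from-H a<m)
  next (from-H a<m)       = inj₁ (_ , flip a<m)
  next (flip a<m)         = inj₁ (_ , close a<m)
  next (close a<m) with m≤n⇒m<n∨m≡n a<m
  ... | inj₁ 1+a<m = inj₁ (_ , open-block 1+a<m)
  ... | inj₂ refl  = inj₂ (refl , refl)

  next-cyclic : ∀ {p x y} → Edge p x y → ∃ (Edge (suc p % length) y)
  next-cyclic {y = y} e with next e
  ... | inj₁ (z , e′) =
    z , subst (λ q → Edge q y z) (sym (m<n⇒m%n≡m (position<length e′))) e′
  -- After the last block comes the opening edge of the first.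
  ... | inj₂ (refl , eq) =
    pos 0 z<s , subst (λ q → Edge q O (pos 0 z<s))
      (sym (trans (cong (_% length) eq) (n%n≡0 length))) (open-block z<s)

  -- Walking around the word.

  walk : ∀ i → ∃₂ (Edge (i % length))
  walk zero    = _ , _ , open-block z<s
  walk (suc i) =
    let _ , y , e = walk i
        z , e′    = next-cyclic e
    in y , z , subst (λ p → Edge p y z) (suc-%-% i length) e′

  -- Reducing `i` before walking makes periodicity immediate, whereas `walk` is recursive in `i`
  -- itself.
  letter : ℕ → Letter
  letter i = proj₁ (walk (i % length))

  -- The wrap-around is the only case where the walk and its reduction modulo the length could
  -- disagree; there both are at position 0.
  walk-source-% : ∀ i → i ≤ length → proj₁ (walk i) ≡ proj₁ (walk (i % length))
  walk-source-% i i≤length with m≤n⇒m<n∨m≡n i≤length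
  ... | inj₁ i<length = cong (λ j → proj₁ (walk j)) (sym (m<n⇒m%n≡m i<length))
  ... | inj₂ refl     = trans (source-at-0 (proj₂ (proj₂ (walk length))) (n%n≡0 length))
                              (cong (λ j → proj₁ (walk j)) (sym (n%n≡0 length)))

  letter-edge : ∀ i → Edge (i % length) (letter i) (letter (suc i))
  letter-edge i = subst₂ (λ p y → Edge p (letter i) y) (m%n%n≡m%n i length)
    -- The target of `walk r` is by definition the source of `walk (suc r)`, but `suc r` may equal
    -- `length`.
    (trans (walk-source-% (suc r) (m%n<n i length)) (cong (λ j → proj₁ (walk j)) (suc-%-% i length)))
    (proj₂ (proj₂ (walk r)))
    where
    r = i % length

  -- The sequence and its properties.

  S : Sequence k
  S i = encode (letter i)

  window-S : ∀ i → window S 2 i ≡ encode (letter i) ∷ encode (letter (suc i)) ∷ []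
  window-S i = cong₂ (λ u v → S u ∷ S v ∷ []) (+-identityʳ i) (+-comm i 1)

  position-of-window : ∀ i j → window S 2 i ≡ window S 2 j → i % length ≡ j % length
  position-of-window i j eq
    with eq₀ , eq′ ← ∷-injective (trans (sym (window-S i)) (trans eq (window-S j)))
    with eq₁ , _ ← ∷-injective eq′ =
    position-unique (letter-edge i)
      (subst₂ (Edge _) (sym (encode-injective eq₀)) (sym (encode-injective eq₁)) (letter-edge j))

  S-distinct : ∀ i j → window S 2 i ≡ window S 2 j → length ∣ ∣ i - j ∣
  S-distinct i j eq = %-≡⇒∣∣-∣ i j length (position-of-window i j eq)

  S-hasPeriod : HasPeriod S length
  S-hasPeriod = record
    { positive = z<s
    ; periodic = λ i → cong (λ r → encode (proj₁ (walk r))) ([m+n]%n≡m%n i length)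
    -- A period p makes the windows at p and 0 equal, so `length` divides p; exposing `suc` lets the
    -- distance from p to 0 compute.
    ; least    = λ { p@(suc _) _ per → ∣⇒≤ (S-distinct p 0
        (tabulate-cong λ j → trans (cong S (+-comm p (toℕ j))) (per (toℕ j)))) }
    }

  S-negativeAvoiding : ∀ i j → window S 2 j ≡ map neg (window S 2 i) → ⊥
  S-negativeAvoiding i j eq
    with eq₀ , eq′ ← ∷-injective
           (trans (sym (window-S j)) (trans eq (cong (map neg) (window-S i))))
    with eq₁ , _ ← ∷-injective eq′ =
    no-negated-edge (letter-edge i)
      (subst₂ (Edge _) (negated eq₀) (negated eq₁) (letter-edge j))
    where
    negated : ∀ {x y} → encode y ≡ neg (encode x) → y ≡ negate x
    negated {x} eq = encode-injective (trans eq (neg-encode x))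

  length-maximal : length ≡ (k ^ 2 ∸ 2 ^ 2) / 2
  length-maximal = sym (begin
    (k ^ 2 ∸ 4) / 2                    ≡⟨ cong (λ t → (t ∸ 4) / 2) (square m) ⟩
    (4 + m * (m + 2) * 2 * 2 ∸ 4) / 2  ≡⟨⟩
    m * (m + 2) * 2 * 2 / 2            ≡⟨ m*n/n≡m (m * (m + 2) * 2) 2 ⟩
    m * (m + 2) * 2                    ≡⟨ blockStart-closed m ⟨
    length                             ∎)
    where
    open ≡-Reasoning
    -- The left side is `k ^ 2` unfolded; the leading 4 on the right lets the subtraction of 4
    -- compute away.
    square : ∀ m → (1 + m + (1 + m)) * ((1 + m + (1 + m)) * 1) ≡ 4 + m * (m + 2) * 2 * 2
    square = solve-∀

  S-isMaximalNAS : 2 ∣ k → IsMaximalNAS 2 S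
  S-isMaximalNAS 2∣k = record
    { period  = length
    ; isNAS   = record
      { 3≤k              = s≤s (s≤s (≤-trans (s≤s z≤n) (m≤n+m (suc m) n)))
      ; 2≤n              = ≤-refl
      ; isWindowSequence = record { hasPeriod = S-hasPeriod ; distinct = S-distinct }
      ; negativeAvoiding = λ { _ (i , refl) (j , eq) → S-negativeAvoiding i j eq }
      }
    ; maxOdd  = λ 2∤k → contradiction 2∣k 2∤k
    ; maxEven = λ _ → length-maximal
    }

theorem6p4 : ∀ (k : ℕ) → 4 ≤ k → 2 ∣ k → Σ (Sequence k) (λ S → IsMaximalNAS 2 S)
-- The quotient 2 + n is `suc m`, so `k` is the sum of two copies of it; 4 ≤ k rules out quotients 0
-- and 1.
theorem6p4 k 4≤k 2∣k@(divides (suc (suc n)) k≡) =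
  subst (λ k → 2 ∣ k → Σ (Sequence k) (IsMaximalNAS 2)) (sym (trans k≡ (double (2 + n))))
    (λ 2∣k → S , S-isMaximalNAS 2∣k) 2∣k
  where
  open Construction n
  double : ∀ q → q * 2 ≡ q + q
  double = solve-∀
theorem6p4 .2 (s≤s (s≤s ())) (divides 1 refl)
theorem6p4 .0 () (divides 0 refl)
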